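{- If $\tau=1000$ or $\tau=1100$, then $$f_\tau(x)=\frac{(1-x)(1-8x+24x^2-31x^3+13x^4+2x^5+2x^6)}{(1-2x)^5}$$ as formal power series in $x$, where $f_\tau(x)=\sum_{n\ge 0} b_n(\tau)x^n$ and $b_n(\tau)$ is the number of ascent sequences of length $n$ that avoid both patterns $021$ and $\tau$.
   Context: For a finite sequence $w=w_1\cdots w_n$ of integers, $\mathrm{asc}(w)$ is the number of indices $1\le i\le n-1$ with $w_i<w_{i+1}$. An ascent sequence of length $n\ge 1$ is a sequence $a_1\cdots a_n$ of non-negative integers such that $a_1=0$ and $a_i\le \mathrm{asc}(a_1\cdots a_{i-1})+1$ for $1<i\le n$; there is exactly one (empty) ascent sequence of length $0$. A sequence $\pi=\pi_1\cdots\pi_n$ contains a pattern $\tau=\tau_1\cdots\tau_m$ if there are indices $1\le i_1<\cdots<i_m\le n$ such that for all $j,k\in\{1,\dots,m\}$: $\pi_{i_j}<\pi_{i_k}$ iff $\tau_j<\tau_k$, and $\pi_{i_j}=\pi_{i_k}$ iff $\tau_j=\tau_k$; otherwise $\pi$ avoids $\tau$. For a pattern $\tau$, $B_n(\tau)$ is the set of ascent sequences of length $n$ avoiding both $021$ and $\tau$ (with $B_0(\tau)$ consisting of the empty sequence), and $b_n(\tau)=|B_n(\tau)|$. -}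

module Defs where

open import Data.Bool.Base using (true; false; if_then_else_)
open import Data.Fin.Base using (Fin; zero; suc; toℕ; finToFun; funToFin)
open import Data.Fin.Properties using (any?; all?; finToFun-funToFin)
import Data.Fin.Base as Fin
import Data.Fin.Properties as Fin
open import Data.Integer.Base using (ℤ; +_; 0ℤ; 1ℤ)
import Data.Integer.Base as ℤ
import Data.Integer.Properties as ℤ
open import Data.List.Base
  using (List; []; _∷_; length; lookup; take; filter; upTo; cartesianProductWith)
open import Data.List.Membership.Propositional using (_∈_)
open import Data.List.Membership.Propositional.Properties
  using (∈-cartesianProductWith⁺; ∈-filter⁺; ∈-filter⁻; ∈-upTo⁺)
import Data.List.Properties as List
open import Data.List.Relation.Unary.Any using (here)
import Data.List.Relation.Unary.All as All
import Data.List.Relation.Unary.AllPairs as AllPairs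
open import Data.List.Relation.Unary.Unique.Propositional using (Unique)
import Data.List.Relation.Unary.Unique.Propositional.Properties as Unique
open import Data.Nat.Base using (ℕ; zero; suc; _+_; _∸_; _^_; _≤_; _<_; _<ᵇ_; z≤n; s≤s)
open import Data.Nat.Properties
  using (_≟_; _≤?_; _<?_; ≤-refl; ≤-trans; ≤-reflexive; +-comm; m≤n⇒m≤1+n; m⊓n≤m)
open import Data.Product.Base using (_×_; _,_; Σ-syntax; proj₂)
open import Function.Base using (_∘_)
open import Function.Bundles using (_⇔_; mk⇔; module Equivalence)
open import Relation.Binary.PropositionalEquality
  using (_≡_; _≗_; refl; sym; trans; cong; subst₂)
open import Relation.Nullary.Decidable
  using (Dec; True; toWitness; map′; ¬?; _×-dec_; _→-dec_)
open import Relation.Nullary.Negation using (¬_)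
open import Algebra.Properties.Monoid.Sum ℤ.+-0-monoid using (sum)
open import Algebra.Properties.AbelianGroup ℤ.+-0-abelianGroup using (xyx⁻¹≈y)

------------------------------------------------------------------------
-- Ascent sequences

asc : List ℕ → ℕ
asc []          = 0
asc (_ ∷ [])    = 0
asc (x ∷ y ∷ w) = (if x <ᵇ y then 1 else 0) + asc (y ∷ w)

-- Positions are 0-based, so `take (toℕ i) w` is the part of w strictly
-- before position i.  The empty word qualifies.
IsAscentSequence : List ℕ → Set
IsAscentSequence w =
    (∀ (i : Fin (length w)) → toℕ i ≡ 0 → lookup w i ≡ 0)
  × (∀ (i : Fin (length w)) → 0 < toℕ i → lookup w i ≤ asc (take (toℕ i) w) + 1)

------------------------------------------------------------------------
-- Pattern containment

IsOccurrence : (π τ : List ℕ) → (Fin (length τ) → Fin (length π)) → Set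
IsOccurrence π τ ι =
    (∀ j k → j Fin.< k → ι j Fin.< ι k)
  × (∀ j k → ((lookup π (ι j) < lookup π (ι k)) ⇔ (lookup τ j < lookup τ k))
           × ((lookup π (ι j) ≡ lookup π (ι k)) ⇔ (lookup τ j ≡ lookup τ k)))

Contains : (π τ : List ℕ) → Set
Contains π τ = Σ[ ι ∈ (Fin (length τ) → Fin (length π)) ] IsOccurrence π τ ι

Avoids : (π τ : List ℕ) → Set
Avoids π τ = ¬ Contains π τ

------------------------------------------------------------------------
-- The set Bₙ(τ)

B : ℕ → List ℕ → List ℕ → Set
B n τ w = length w ≡ n
        × IsAscentSequence w
        × Avoids w (0 ∷ 2 ∷ 1 ∷ [])
        × Avoids w τ

private
  _⇔-dec_ : {P Q : Set} → Dec P → Dec Q → Dec (P ⇔ Q)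
  p? ⇔-dec q? = map′ (λ (f , g) → mk⇔ f g)
                     (λ e → Equivalence.to e , Equivalence.from e)
                     ((p? →-dec q?) ×-dec (q? →-dec p?))

isAscentSequence? : ∀ w → Dec (IsAscentSequence w)
isAscentSequence? w =
        all? (λ i → (toℕ i ≟ 0) →-dec (lookup w i ≟ 0))
  ×-dec all? (λ i → (0 <? toℕ i) →-dec (lookup w i ≤? asc (take (toℕ i) w) + 1))

isOccurrence? : ∀ π τ ι → Dec (IsOccurrence π τ ι)
isOccurrence? π τ ι =
        all? (λ j → all? λ k → (j Fin.<? k) →-dec (ι j Fin.<? ι k))
  ×-dec all? (λ j → all? λ k →
          ((lookup π (ι j) <? lookup π (ι k)) ⇔-dec (lookup τ j <? lookup τ k))
    ×-dec ((lookup π (ι j) ≟ lookup π (ι k)) ⇔-dec (lookup τ j ≟ lookup τ k)))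

isOccurrence-resp-≗ : ∀ π τ {ι κ} → ι ≗ κ → IsOccurrence π τ ι → IsOccurrence π τ κ
isOccurrence-resp-≗ π τ ι≗κ (mono , iso) =
    (λ j k j<k → subst₂ Fin._<_ (ι≗κ j) (ι≗κ k) (mono j k j<k))
  , (λ j k → subst₂
      (λ a b → ((lookup π a < lookup π b) ⇔ (lookup τ j < lookup τ k))
             × ((lookup π a ≡ lookup π b) ⇔ (lookup τ j ≡ lookup τ k)))
      (ι≗κ j) (ι≗κ k) (iso j k))

contains? : ∀ π τ → Dec (Contains π τ)
contains? π τ =
  map′ (λ (c , occ) → finToFun c , occ)
       (λ (ι , occ) → funToFin ι ,
          isOccurrence-resp-≗ π τ (sym ∘ finToFun-funToFin ι) occ)
       (any? {n = length π ^ length τ} (isOccurrence? π τ ∘ finToFun))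

B? : ∀ n τ w → Dec (B n τ w)
B? n τ w =
        (length w ≟ n)
  ×-dec isAscentSequence? w
  ×-dec ¬? (contains? w (0 ∷ 2 ∷ 1 ∷ []))
  ×-dec ¬? (contains? w τ)

-- All words of length n over the alphabet {0, …, k - 1}.
words : (k n : ℕ) → List (List ℕ)
words k zero    = [] ∷ []
words k (suc n) = cartesianProductWith _∷_ (upTo k) (words k n)

-- The entries of an ascent sequence of length n are smaller than n, so
-- searching `words n n` loses nothing; `∈-listB` and `listB-unique` below
-- show that listB n τ lists the elements of Bₙ(τ), each exactly once.
listB : ℕ → List ℕ → List (List ℕ)
listB n τ = filter (B? n τ) (words n n)

b : ℕ → List ℕ → ℕ
b n τ = length (listB n τ)

words-unique : ∀ k n → Unique (words k n)
words-unique k zero    = All.[] AllPairs.∷ AllPairs.[]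
words-unique k (suc n) =
  Unique.cartesianProductWith⁺ _∷_ List.∷-injective (Unique.upTo⁺ k) (words-unique k n)

∈-words : ∀ k w → (∀ i → lookup w i < k) → w ∈ words k (length w)
∈-words k []      _   = here refl
∈-words k (x ∷ w) w<k =
  ∈-cartesianProductWith⁺ _∷_ (∈-upTo⁺ (w<k zero)) (∈-words k w (w<k ∘ suc))

asc-∷ : ∀ x w → asc (x ∷ w) ≤ length w
asc-∷ x []      = z≤n
asc-∷ x (y ∷ w) with x <ᵇ y
... | true  = s≤s (asc-∷ y w)
... | false = m≤n⇒m≤1+n (asc-∷ y w)

ascentSequence-bound : ∀ w → IsAscentSequence w → ∀ i → lookup w i < length w
ascentSequence-bound (x ∷ w) (first , _) zero    = s≤s (≤-trans (≤-reflexive (first zero refl)) z≤n)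
ascentSequence-bound (x ∷ w) (_ , rest)  (suc i) =
  s≤s (≤-trans (rest (suc i) (s≤s z≤n))
      (≤-trans (≤-reflexive (+-comm _ 1))
      (≤-trans (s≤s (asc-∷ x (take (toℕ i) w)))
      (≤-trans (s≤s (≤-trans (≤-reflexive (List.length-take (toℕ i) w)) (m⊓n≤m (toℕ i) _)))
               (Fin.toℕ<n i)))))

∈-listB : ∀ n τ w → (w ∈ listB n τ) ⇔ B n τ w
∈-listB n τ w = mk⇔ sound complete
  where
  sound : w ∈ listB n τ → B n τ w
  sound w∈ = proj₂ (∈-filter⁻ {P = B n τ} (B? n τ) {w} {words n n} w∈)

  complete : B n τ w → w ∈ listB n τ
  complete w∈B@(refl , isAsc , _) =
    ∈-filter⁺ {P = B n τ} (B? n τ) {w} {words n n}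
      (∈-words n w (ascentSequence-bound w isAsc)) w∈B

listB-unique : ∀ n τ → Unique (listB n τ)
listB-unique n τ = Unique.filter⁺ {P = B n τ} (B? n τ) {words n n} (words-unique n n)

------------------------------------------------------------------------
-- Formal power series over ℤ, as coefficient sequences; equality of
-- series is _≗_.

PowerSeries : Set
PowerSeries = ℕ → ℤ

-- The polynomial with the given coefficients, constant term first.
poly : List ℤ → PowerSeries
poly []       _       = 0ℤ
poly (a ∷ _)  zero    = a
poly (_ ∷ as) (suc n) = poly as n

infixl 7 _⊛_ _÷_
infixr 8 _^ₛ_

_⊛_ : PowerSeries → PowerSeries → PowerSeries
(p ⊛ q) n = sum {suc n} λ i → p (toℕ i) ℤ.* q (n ∸ toℕ i)

_^ₛ_ : PowerSeries → ℕ → PowerSeries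
p ^ₛ zero  = poly (1ℤ ∷ [])
p ^ₛ suc n = p ⊛ (p ^ₛ n)

-- Long division by a series with constant term 1; `÷-⊛` shows that
-- p ÷ q is the quotient in ℤ[[x]].
_÷_ : (p q : PowerSeries) → {True (q 0 ℤ.≟ 1ℤ)} → PowerSeries
(p ÷ q)        zero    = p 0
(p ÷ q) {q₀≡1} (suc n) = ((λ k → p (suc k) ℤ.- p 0 ℤ.* q (suc k)) ÷ q) {q₀≡1} n

÷-⊛ : ∀ p q {q₀≡1 : True (q 0 ℤ.≟ 1ℤ)} → (p ÷ q) {q₀≡1} ⊛ q ≗ p
÷-⊛ p q {q₀≡1} zero    =
  trans (ℤ.+-identityʳ _) (trans (cong (p 0 ℤ.*_) (toWitness q₀≡1)) (ℤ.*-identityʳ (p 0)))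
÷-⊛ p q {q₀≡1} (suc n) =
  trans (cong (λ s → a ℤ.+ s) (÷-⊛ (λ k → p (suc k) ℤ.- p 0 ℤ.* q (suc k)) q {q₀≡1} n))
        (trans (sym (ℤ.+-assoc a (p (suc n)) (ℤ.- a))) (xyx⁻¹≈y a (p (suc n))))
  where
  a = p 0 ℤ.* q (suc n)

f : List ℕ → PowerSeries
f τ n = + b n τ

{-# OPTIONS --safe #-}
-- A sequence starting with 0 avoids 021 exactly when its nonzero letters weakly increase, and then
-- the only way to contain 1000 is to have three zeros after the first nonzero letter, while 1100
-- requires two zeros after the first repeated nonzero letter.  Reading a sequence from left to right,
-- the admissible next letters therefore depend only on the excess of the number of ascents over the
-- maximum, on whether the last letter is zero, and on how many zeros may still follow.  Since only
-- boundedly many zeros remain once the excess can grow, finitely many such states occur.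
-- The transition matrix has only the eigenvalues 0 and 2, apart from the eigenvalue 1 of the initial
-- run of zeros.  Hence the fifth power of g(n) ↦ g(n + 1) - 2 g(n) eventually makes the
-- counting sequence constant, and one computed value shows that this constant is 0.
module Submission where

open import Defs
open import Data.Bool.Base using (if_then_else_)
open import Data.Bool.Properties using (T-≡)
open import Data.Fin.Base using (Fin; zero; suc; toℕ; fromℕ<)
import Data.Fin.Base as Fin
open import Data.Fin.Properties using (toℕ-fromℕ<; all?)
open import Data.Integer.Base using (ℤ; +_; -_; 0ℤ; 1ℤ)
import Data.Integer.Base as ℤ
import Data.Integer.Properties as ℤ
open import Data.Integer.Solver using (module +-*-Solver)
open import Data.List.Base
  using (List; []; _∷_; [_]; _++_; length; lookup; map; take; replicate; tabulate; applyUpTo)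
open import Data.List.Membership.Propositional using (_∈_)
open import Data.List.Membership.Propositional.Properties
  using (∈-map⁺; ∈-map⁻; ∈-++⁺ˡ; ∈-++⁺ʳ; ∈-++⁻; ∈-applyUpTo⁺)
open import Data.List.Membership.Propositional.Properties.WithK using (unique∧set⇒bag)
import Data.List.Properties as List
open import Data.List.Relation.Binary.BagAndSetEquality using (∼bag⇒↭)
open import Data.List.Relation.Binary.Permutation.Propositional.Properties using (↭-length)
open import Data.List.Relation.Binary.Pointwise.Base using (Pointwise; []; _∷_)
open import Data.List.Relation.Binary.Sublist.Propositional
  using (_⊆_; []; _∷_; _∷ʳ_; minimum; ⊆-refl; ⊆-trans)
open import Data.List.Relation.Binary.Sublist.Propositional.Properties using (∷⁻; ∷ʳ⁻)
open import Data.List.Relation.Unary.All as All using ([]; _∷_)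
import Data.List.Relation.Unary.All.Properties as All
open import Data.List.Relation.Unary.AllPairs using ([]; _∷_)
open import Data.List.Relation.Unary.Any using (here; there)
open import Data.List.Relation.Unary.Unique.Propositional using (Unique)
import Data.List.Relation.Unary.Unique.Propositional.Properties as Unique
open import Data.Nat.Base
import Data.Nat.ListAction as List
open import Data.Nat.Properties
import Data.Nat.Solver as ℕ
open import Data.Product.Base using (_×_; _,_; proj₁; proj₂; ∃; ∃₂)
open import Data.Sum.Base using (_⊎_; inj₁; inj₂)
open import Data.Unit.Base using (⊤; tt)
open import Function.Base using (_∘_)
open import Function.Bundles using (_⇔_; mk⇔; module Equivalence)
open import Function.Construct.Composition using (_⇔-∘_)
open import Function.Construct.Symmetry using (⇔-sym)
open import Relation.Binary.Core using (_Preserves_⟶_)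
open import Relation.Binary.Definitions using (tri<; tri≈; tri>)
open import Relation.Binary.PropositionalEquality hiding ([_])
open import Relation.Nullary.Decidable using (True; toWitness; yes; no)
open import Relation.Nullary.Negation using (¬_; contradiction)
open import Algebra.Properties.Monoid.Sum ℤ.+-0-monoid using (sum-replicate-zero; sum-cong-≗)
open Equivalence using (to; from)

-- Division of power series and the operator g(n) ↦ g(n + 1) - 2 g(n)

-- Since `q 0` is 1, the constant terms agree; the tail of `g` then satisfies the same hypothesis
-- for the remainder that long division passes on.
÷-unique : ∀ g p q {q₀≡1 : True (q 0 ℤ.≟ 1ℤ)} → g ⊛ q ≗ p → g ≗ (p ÷ q) {q₀≡1}
÷-unique g p q {q₀≡1} g⊛q≗p = go
  where
  head≡ : g 0 ≡ p 0
  head≡ = trans (sym (trans (ℤ.+-identityʳ _)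
                            (trans (cong (g 0 ℤ.*_) (toWitness q₀≡1)) (ℤ.*-identityʳ (g 0)))))
                (g⊛q≗p 0)

  tail≗ : (g ∘ suc) ⊛ q ≗ (λ k → p (suc k) ℤ.- p 0 ℤ.* q (suc k))
  tail≗ k = begin
    s                      ≡⟨ solve 2 (λ a s → s := (a :+ s) :- a) refl a s ⟩
    (a ℤ.+ s) ℤ.- a        ≡⟨ cong₂ ℤ._-_ (g⊛q≗p (suc k)) (cong (ℤ._* q (suc k)) head≡) ⟩
    p (suc k) ℤ.- p 0 ℤ.* q (suc k) ∎
    where
    open ≡-Reasoning
    open +-*-Solver
    a = g 0 ℤ.* q (suc k)
    s = ((g ∘ suc) ⊛ q) k

  go : g ≗ (p ÷ q) {q₀≡1}
  go zero    = head≡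
  go (suc n) = ÷-unique (g ∘ suc) _ q {q₀≡1} tail≗ n

linear-⊛ : ∀ a b p n → (poly (a ∷ b ∷ []) ⊛ p) (suc n) ≡ a ℤ.* p (suc n) ℤ.+ b ℤ.* p n
linear-⊛ a b p n = cong (λ s → a ℤ.* p (suc n) ℤ.+ s)
  (trans (cong (λ s → b ℤ.* p n ℤ.+ s) (sum-replicate-zero n)) (ℤ.+-identityʳ _))

-- Coefficients of (a + b x) p, where p is given by xs and c is the coefficient preceding xs.
linearMul : (a b c : ℤ) → List ℤ → List ℤ
linearMul a b c []       = b ℤ.* c ∷ []
linearMul a b c (x ∷ xs) = a ℤ.* x ℤ.+ b ℤ.* c ∷ linearMul a b x xs

poly-linearMul : ∀ a b c xs n →
  poly (linearMul a b c xs) (suc n) ≡ a ℤ.* poly xs (suc n) ℤ.+ b ℤ.* poly xs n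
poly-linearMul a b c []           n       = sym (cong₂ ℤ._+_ (ℤ.*-zeroʳ a) (ℤ.*-zeroʳ b))
poly-linearMul a b c (x ∷ [])     zero    =
  sym (trans (cong (ℤ._+ b ℤ.* x) (ℤ.*-zeroʳ a)) (ℤ.+-identityˡ (b ℤ.* x)))
poly-linearMul a b c (x ∷ y ∷ xs) zero    = refl
poly-linearMul a b c (x ∷ xs)     (suc n) = poly-linearMul a b x xs n

linear-⊛-poly : ∀ a b x xs {p} → p ≗ poly (x ∷ xs) →
  poly (a ∷ b ∷ []) ⊛ p ≗ poly (linearMul a b 0ℤ (x ∷ xs))
linear-⊛-poly a b x xs p≗ zero    = cong₂ (λ u v → a ℤ.* u ℤ.+ v) (p≗ 0) (sym (ℤ.*-zeroʳ b))
linear-⊛-poly a b x xs {p} p≗ (suc n) = begin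
  (poly (a ∷ b ∷ []) ⊛ p) (suc n)                        ≡⟨ linear-⊛ a b p n ⟩
  a ℤ.* p (suc n) ℤ.+ b ℤ.* p n
    ≡⟨ cong₂ (λ u v → a ℤ.* u ℤ.+ b ℤ.* v) (p≗ (suc n)) (p≗ n) ⟩
  a ℤ.* poly (x ∷ xs) (suc n) ℤ.+ b ℤ.* poly (x ∷ xs) n  ≡⟨ sym (poly-linearMul a b 0ℤ (x ∷ xs) n) ⟩
  poly (linearMul a b 0ℤ (x ∷ xs)) (suc n)               ∎
  where open ≡-Reasoning

numerator denominator : PowerSeries
numerator   = poly (+ 1 ∷ - + 1 ∷ []) ⊛ poly (+ 1 ∷ - + 8 ∷ + 24 ∷ - + 31 ∷ + 13 ∷ + 2 ∷ + 2 ∷ [])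
denominator = poly (+ 1 ∷ - + 2 ∷ []) ^ₛ 5

-- The same polynomials multiplied out, so that their degrees 7 and 5 are visible and higher
-- coefficients vanish by computation.
numerator′ denominator′ : PowerSeries
numerator′   = poly (+ 1 ∷ - + 9 ∷ + 32 ∷ - + 55 ∷ + 44 ∷ - + 11 ∷ 0ℤ ∷ - + 2 ∷ [])
denominator′ = poly (+ 1 ∷ - + 10 ∷ + 40 ∷ - + 80 ∷ + 80 ∷ - + 32 ∷ [])

numerator≗ : numerator ≗ numerator′
numerator≗ = linear-⊛-poly (+ 1) (- + 1) (+ 1) _ λ _ → refl

denominator≗ : denominator ≗ denominator′
denominator≗ = step (step (step (step (step λ _ → refl))))
  where
  step : ∀ {x xs p} → p ≗ poly (x ∷ xs) →
         poly (+ 1 ∷ - + 2 ∷ []) ⊛ p ≗ poly (linearMul (+ 1) (- + 2) 0ℤ (x ∷ xs))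
  step = linear-⊛-poly (+ 1) (- + 2) _ _

-- On generating functions, this multiplies by 1 - 2x, drops the constant term and divides by x.
Δ : PowerSeries → PowerSeries
Δ g n = g (suc n) ℤ.- + 2 ℤ.* g n

infixr 8 Δ^_

Δ^_ : ℕ → PowerSeries → PowerSeries
(Δ^ zero)  g = g
(Δ^ suc j) g = (Δ^ j) (Δ g)

Δ^-cong : ∀ j {g h} → g ≗ h → (Δ^ j) g ≗ (Δ^ j) h
Δ^-cong zero    g≗h = g≗h
Δ^-cong (suc j) g≗h = Δ^-cong j λ n → cong₂ (λ a b → a ℤ.- + 2 ℤ.* b) (g≗h (suc n)) (g≗h n)

Δ^-+ : ∀ j g h n → (Δ^ j) (λ i → g i ℤ.+ h i) n ≡ (Δ^ j) g n ℤ.+ (Δ^ j) h n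
Δ^-+ zero    g h n = refl
Δ^-+ (suc j) g h n = trans (Δ^-cong j distrib n) (Δ^-+ j (Δ g) (Δ h) n)
  where
  open +-*-Solver
  distrib : Δ (λ i → g i ℤ.+ h i) ≗ (λ i → Δ g i ℤ.+ Δ h i)
  distrib i = solve 4 (λ a b c d → (a :+ b) :- con (+ 2) :* (c :+ d)
                                 := (a :- con (+ 2) :* c) :+ (b :- con (+ 2) :* d))
                      refl (g (suc i)) (h (suc i)) (g i) (h i)

Δ^-shift : ∀ j g m → (Δ^ j) (λ n → g (m + n)) ≗ (λ n → (Δ^ j) g (m + n))
Δ^-shift zero    g m n = refl
Δ^-shift (suc j) g m n = trans
  (Δ^-cong j (λ i → cong (λ k → g k ℤ.- + 2 ℤ.* g (m + i)) (+-suc m i)) n)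
  (Δ^-shift j (Δ g) m n)

Δ^-Δ : ∀ j g → (Δ^ j) (Δ g) ≗ Δ ((Δ^ j) g)
Δ^-Δ zero    g n = refl
Δ^-Δ (suc j) g n = Δ^-Δ j (Δ g) n

-- Both sides expand (E - 2)^5 at 0, where E is the shift; the nested `δ` mirror the unfolding of
-- `Δ^ 5`.
Δ⁵-⊛ : ∀ g → (g ⊛ denominator′) 5 ≡ (Δ^ 5) g 0
Δ⁵-⊛ g = solve 6
  (λ a b c d e f →
     a :* con (- + 32) :+ (b :* con (+ 80) :+ (c :* con (- + 80) :+ (d :* con (+ 40)
       :+ (e :* con (- + 10) :+ (f :* con (+ 1) :+ con 0ℤ)))))
   := δ (δ (δ (δ (δ f e) (δ e d)) (δ (δ e d) (δ d c)))
           (δ (δ (δ e d) (δ d c)) (δ (δ d c) (δ c b))))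
        (δ (δ (δ (δ e d) (δ d c)) (δ (δ d c) (δ c b)))
           (δ (δ (δ d c) (δ c b)) (δ (δ c b) (δ b a)))))
  refl (g 0) (g 1) (g 2) (g 3) (g 4) (g 5)
  where
  open +-*-Solver
  δ : ∀ {n} → Polynomial n → Polynomial n → Polynomial n
  δ x y = x :- con (+ 2) :* y

⊛-denominator : ∀ m g → (g ⊛ denominator′) (m + 5) ≡ (Δ^ 5) g m
⊛-denominator zero    g = Δ⁵-⊛ g
⊛-denominator (suc m) g = begin
  g 0 ℤ.* denominator′ (suc (m + 5)) ℤ.+ ((g ∘ suc) ⊛ denominator′) (m + 5)
    ≡⟨ cong₂ (λ x y → g 0 ℤ.* x ℤ.+ y)
             -- Commuting exposes an index of at least 6, beyond the degree of `denominator′`.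
             (cong (denominator′ ∘ suc) (+-comm m 5))
             (⊛-denominator m (g ∘ suc)) ⟩
  g 0 ℤ.* 0ℤ ℤ.+ (Δ^ 5) (g ∘ suc) m  ≡⟨ cong₂ ℤ._+_ (ℤ.*-zeroʳ (g 0)) (Δ^-shift 5 g 1 m) ⟩
  0ℤ ℤ.+ (Δ^ 5) g (suc m)            ≡⟨ ℤ.+-identityˡ _ ⟩
  (Δ^ 5) g (suc m)                   ∎
  where open ≡-Reasoning

-- From index 8 = 3 + 5 on, the numerator of degree 7 vanishes, and coefficient n + 5 of
-- `g ⊛ denominator′` is `(Δ^ 5) g n`.
quotient-criterion : ∀ g → (∀ (i : Fin 8) → (g ⊛ denominator′) (toℕ i) ≡ numerator′ (toℕ i)) →
  (∀ n → (Δ^ 5) g (3 + n) ≡ 0ℤ) → g ≗ numerator ÷ denominator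
quotient-criterion g small large = ÷-unique g numerator denominator λ n →
  trans (sum-cong-≗ {suc n} λ i → cong (g (toℕ i) ℤ.*_) (denominator≗ (n ∸ toℕ i)))
        (trans (agree n) (sym (numerator≗ n)))
  where
  open ≡-Reasoning
  agree : g ⊛ denominator′ ≗ numerator′
  agree n with n <? 8
  ... | yes n<8 =
    subst (λ k → (g ⊛ denominator′) k ≡ numerator′ k) (toℕ-fromℕ< n<8) (small (fromℕ< n<8))
  ... | no n≮8  = subst (λ k → (g ⊛ denominator′) k ≡ numerator′ k) (m+[n∸m]≡n (≮⇒≥ n≮8)) (begin
      (g ⊛ denominator′) (8 + (n ∸ 8))        ≡⟨ cong (g ⊛ denominator′) (+-comm 5 (3 + (n ∸ 8))) ⟩
      (g ⊛ denominator′) ((3 + (n ∸ 8)) + 5)  ≡⟨ ⊛-denominator (3 + (n ∸ 8)) g ⟩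
      (Δ^ 5) g (3 + (n ∸ 8))                  ≡⟨ large (n ∸ 8) ⟩
      0ℤ                                      ∎)

-- Counting sequences

-- afterMax k s n and afterZero k s n count the ways to append n letters while placing fewer than
-- k zeros, when the number of ascents exceeds the maximum by s and the last letter is the maximum,
-- respectively zero.  In the sums, i is the new value of s after a letter above the maximum.
afterMax afterZero : (k s n : ℕ) → ℕ
afterMax zero    s n       = 0
afterMax (suc k) s zero    = 1
afterMax (suc k) s (suc n) =
  afterZero k s n + (afterMax (suc k) s n + List.sum (applyUpTo (λ i → afterMax (suc k) i n) (suc s)))
afterZero zero    s n       = 0
afterZero (suc k) s zero    = 1
afterZero (suc k) s (suc n) =
  -- After a zero, repeating the maximum is an ascent too and raises the excess to `suc s`; hence
  -- one summand more than in `afterMax`.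
  afterZero k s n + List.sum (applyUpTo (λ i → afterMax (suc k) i n) (suc (suc s)))

-- The analogous counts for 1100 as long as the nonzero letters are distinct; repeating the maximum
-- leads to afterMax 2.
strictMax strictZero : ℕ → ℕ
strictMax  zero    = 1
strictMax  (suc n) = strictZero n + (afterMax 2 0 n + strictMax n)
strictZero zero    = 1
-- Here the repeated maximum follows a zero, so it is an ascent and the excess becomes 1.
strictZero (suc n) = strictZero n + (afterMax 2 1 n + strictMax n)

-- If `h` counts the continuations after the first nonzero letter, this counts the words after the
-- initial 0; the 1 stands for the all-zero word.
partialSum : (ℕ → ℕ) → ℕ → ℕ
partialSum h zero    = 1
partialSum h (suc n) = partialSum h n + h n

-- Equivalently, the generating function of g, up to a polynomial of degree less than k, is a
-- proper fraction with denominator (1 - 2x)^j.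
record Annihilated (j k : ℕ) (g : ℕ → ℕ) : Set where
  constructor annihilated
  field vanishes : ∀ n → (Δ^ j) (+_ ∘ g) (k + n) ≡ 0ℤ

open Annihilated

annihilated-sucˡ : ∀ {j k g} → Annihilated j k g → Annihilated (suc j) k g
annihilated-sucˡ {j} {k} {g} ann .vanishes n = begin
  (Δ^ suc j) (+_ ∘ g) (k + n)    ≡⟨ Δ^-Δ j (+_ ∘ g) (k + n) ⟩
  Δ ((Δ^ j) (+_ ∘ g)) (k + n)
    ≡⟨ cong₂ (λ a b → a ℤ.- + 2 ℤ.* b)
             (trans (cong ((Δ^ j) (+_ ∘ g)) (sym (+-suc k n))) (vanishes ann (suc n)))
             (vanishes ann n) ⟩
  0ℤ                             ∎
  where open ≡-Reasoning

annihilated-0 : ∀ j k → Annihilated j k (λ _ → 0)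
annihilated-0 zero    k = annihilated λ _ → refl
annihilated-0 (suc j) k = annihilated (vanishes (annihilated-0 j k))

annihilated-+ : ∀ {j k g h} → Annihilated j k g → Annihilated j k h →
  Annihilated j k (λ n → g n + h n)
annihilated-+ {j} {k} {g} {h} annᵍ annʰ .vanishes n =
  trans (Δ^-+ j (+_ ∘ g) (+_ ∘ h) (k + n)) (cong₂ ℤ._+_ (vanishes annᵍ n) (vanishes annʰ n))

-- The eigenvalue 0: a sequence absent from its own recurrence costs one more initial index, but no
-- power of `Δ`.
annihilated-shift : ∀ {j k g h} → g ∘ suc ≗ h → Annihilated j k h → Annihilated j (suc k) g
annihilated-shift {j} {k} {g} {h} g∘suc≗h ann .vanishes n = begin
  (Δ^ j) (+_ ∘ g) (suc (k + n))  ≡⟨ sym (Δ^-shift j (+_ ∘ g) 1 (k + n)) ⟩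
  (Δ^ j) (+_ ∘ g ∘ suc) (k + n)  ≡⟨ Δ^-cong j (cong +_ ∘ g∘suc≗h) (k + n) ⟩
  (Δ^ j) (+_ ∘ h) (k + n)        ≡⟨ vanishes ann n ⟩
  0ℤ                             ∎
  where open ≡-Reasoning

-- The eigenvalue 2: the recurrence says that `Δ` maps `g` to `h`.
annihilated-doubling : ∀ {j k g h} → (∀ n → g (suc n) ≡ 2 * g n + h n) →
  Annihilated j k h → Annihilated (suc j) k g
annihilated-doubling {j} {k} {g} {h} step ann .vanishes n =
  trans (Δ^-cong j Δg≗h (k + n)) (vanishes ann n)
  where
  open +-*-Solver
  Δg≗h : Δ (+_ ∘ g) ≗ (+_ ∘ h)
  Δg≗h i = trans
    (cong₂ ℤ._-_ (trans (cong +_ (step i)) (ℤ.pos-+ (2 * g i) (h i))) (sym (ℤ.pos-* 2 (g i))))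
    (solve 2 (λ a b → (a :+ b) :- a := b) refl (+ (2 * g i)) (+ h i))

-- The eigenvalue 1: from index `k` on, the `j`-th iterate of `Δ` on the partial sums has
-- differences 0, so it is constant, and its value at `k` decides.
annihilated-partialSum : ∀ {j k h} → Annihilated j k h →
  (Δ^ j) (+_ ∘ partialSum h) k ≡ 0ℤ → Annihilated j k (partialSum h)
annihilated-partialSum {j} {k} {h} ann start = annihilated go
  where
  open ≡-Reasoning
  A = partialSum h
  go : ∀ n → (Δ^ j) (+_ ∘ A) (k + n) ≡ 0ℤ
  go zero    = trans (cong ((Δ^ j) (+_ ∘ A)) (+-identityʳ k)) start
  go (suc n) = begin
    (Δ^ j) (+_ ∘ A) (k + suc n)                          ≡⟨ cong ((Δ^ j) (+_ ∘ A)) (+-suc k n) ⟩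
    (Δ^ j) (+_ ∘ A) (suc (k + n))                        ≡⟨ sym (Δ^-shift j (+_ ∘ A) 1 (k + n)) ⟩
    (Δ^ j) (λ i → + A i ℤ.+ + h i) (k + n)               ≡⟨ Δ^-+ j (+_ ∘ A) (+_ ∘ h) (k + n) ⟩
    (Δ^ j) (+_ ∘ A) (k + n) ℤ.+ (Δ^ j) (+_ ∘ h) (k + n)  ≡⟨ cong₂ ℤ._+_ (go n) (vanishes ann n) ⟩
    0ℤ                                                   ∎

-- In this and the next two recurrences the factor 2 arises because two letters preserve the excess:
-- the maximum itself and its successor.
afterMax-zero-suc : ∀ k n →
  afterMax (suc k) 0 (suc n) ≡ 2 * afterMax (suc k) 0 n + afterZero k 0 n
afterMax-zero-suc k n =
  solve 2 (λ z m → z :+ (m :+ (m :+ con 0)) := con 2 :* m :+ z) refl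
    (afterZero k 0 n) (afterMax (suc k) 0 n)
  where open ℕ.+-*-Solver

afterMax-one-suc : ∀ k n →
  afterMax (suc k) 1 (suc n) ≡ 2 * afterMax (suc k) 1 n + (afterMax (suc k) 0 n + afterZero k 1 n)
afterMax-one-suc k n =
  solve 3 (λ z m m₀ → z :+ (m :+ (m₀ :+ (m :+ con 0))) := con 2 :* m :+ (m₀ :+ z)) refl
    (afterZero k 1 n) (afterMax (suc k) 1 n) (afterMax (suc k) 0 n)
  where open ℕ.+-*-Solver

afterMax-two-suc : ∀ k n →
  afterMax (suc k) 2 (suc n) ≡
  2 * afterMax (suc k) 2 n + (afterMax (suc k) 0 n + afterMax (suc k) 1 n + afterZero k 2 n)
afterMax-two-suc k n =
  solve 4 (λ z m m₀ m₁ → z :+ (m :+ (m₀ :+ (m₁ :+ (m :+ con 0))))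
                      := con 2 :* m :+ (m₀ :+ m₁ :+ z)) refl
    (afterZero k 2 n) (afterMax (suc k) 2 n) (afterMax (suc k) 0 n) (afterMax (suc k) 1 n)
  where open ℕ.+-*-Solver

afterZero-zero-suc : ∀ k n → afterZero (suc k) 0 (suc n) ≡
  afterZero k 0 n + (afterMax (suc k) 0 n + afterMax (suc k) 1 n)
afterZero-zero-suc k n = cong (λ m → afterZero k 0 n + (afterMax (suc k) 0 n + m))
                              (+-identityʳ (afterMax (suc k) 1 n))

afterZero-one-suc : ∀ k n → afterZero (suc k) 1 (suc n) ≡
  afterZero k 1 n + (afterMax (suc k) 0 n + (afterMax (suc k) 1 n + afterMax (suc k) 2 n))
afterZero-one-suc k n =
  cong (λ m → afterZero k 1 n + (afterMax (suc k) 0 n + (afterMax (suc k) 1 n + m)))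
       (+-identityʳ (afterMax (suc k) 2 n))

-- The subscripts are `k` and `s`. From `afterMax 3 0`, each zero lowers `k` by one, and the letter
-- after it raises `s` by at most one. So k + s stays at most 3, and these nine sequences suffice.
ann-afterMax₁₀ : Annihilated 1 0 (afterMax 1 0)
ann-afterMax₁₀ = annihilated-doubling (afterMax-zero-suc 0) (annihilated-0 0 0)

ann-afterMax₁₁ : Annihilated 2 0 (afterMax 1 1)
ann-afterMax₁₁ = annihilated-doubling (afterMax-one-suc 0)
  (annihilated-+ ann-afterMax₁₀ (annihilated-0 1 0))

ann-afterMax₁₂ : Annihilated 3 0 (afterMax 1 2)
ann-afterMax₁₂ = annihilated-doubling (afterMax-two-suc 0)
  (annihilated-+ (annihilated-+ (annihilated-sucˡ ann-afterMax₁₀) ann-afterMax₁₁)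
                   (annihilated-0 2 0))

ann-afterZero₁₀ : Annihilated 2 1 (afterZero 1 0)
ann-afterZero₁₀ = annihilated-shift (afterZero-zero-suc 0)
  (annihilated-+ (annihilated-0 2 0)
    (annihilated-+ (annihilated-sucˡ ann-afterMax₁₀) ann-afterMax₁₁))

ann-afterZero₁₁ : Annihilated 3 1 (afterZero 1 1)
ann-afterZero₁₁ = annihilated-shift (afterZero-one-suc 0)
  (annihilated-+ (annihilated-0 3 0)
    (annihilated-+ (annihilated-sucˡ (annihilated-sucˡ ann-afterMax₁₀))
      (annihilated-+ (annihilated-sucˡ ann-afterMax₁₁) ann-afterMax₁₂)))

ann-afterMax₂₀ : Annihilated 3 1 (afterMax 2 0)
ann-afterMax₂₀ = annihilated-doubling (afterMax-zero-suc 1) ann-afterZero₁₀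

ann-afterMax₂₁ : Annihilated 4 1 (afterMax 2 1)
ann-afterMax₂₁ = annihilated-doubling (afterMax-one-suc 1)
  (annihilated-+ ann-afterMax₂₀ ann-afterZero₁₁)

ann-afterZero₂₀ : Annihilated 4 2 (afterZero 2 0)
ann-afterZero₂₀ = annihilated-shift (afterZero-zero-suc 1)
  (annihilated-+ (annihilated-sucˡ (annihilated-sucˡ ann-afterZero₁₀))
    (annihilated-+ (annihilated-sucˡ ann-afterMax₂₀) ann-afterMax₂₁))

ann-afterMax₃₀ : Annihilated 5 2 (afterMax 3 0)
ann-afterMax₃₀ = annihilated-doubling (afterMax-zero-suc 2) ann-afterZero₂₀

ann-strictMax : Annihilated 5 2 strictMax
ann-strictMax = annihilated-shift regroup
  (annihilated-+ strictSum (annihilated-sucˡ (annihilated-sucˡ ann-afterMax₂₀)))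
  where
  open ℕ.+-*-Solver
  regroup : strictMax ∘ suc ≗ (λ n → strictMax n + strictZero n + afterMax 2 0 n)
  regroup n = solve 3 (λ p q m → q :+ (m :+ p) := p :+ q :+ m) refl
    (strictMax n) (strictZero n) (afterMax 2 0 n)

  -- The two sequences feed each other through the all-ones matrix, with eigenvalues 2 and 0; their
  -- sum belongs to the eigenvalue 2.
  strictSum : Annihilated 5 1 (λ n → strictMax n + strictZero n)
  strictSum = annihilated-doubling
    (λ n → solve 4 (λ p q m₀ m₁ → (q :+ (m₀ :+ p)) :+ (q :+ (m₁ :+ p))
                                := con 2 :* (p :+ q) :+ (m₀ :+ m₁)) refl
             (strictMax n) (strictZero n) (afterMax 2 0 n) (afterMax 2 1 n))
    (annihilated-+ (annihilated-sucˡ ann-afterMax₂₀) ann-afterMax₂₁)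

series : (ℕ → ℕ) → PowerSeries
series h zero    = 1ℤ
series h (suc n) = + partialSum h n

-- The leading 1 for the empty sequence shifts the partial sums by one, so index 2 in `ann` becomes
-- index 3 in `start`. What remains is a finite computation.
series≗quotient : ∀ h → Annihilated 5 2 h → (Δ^ 5) (series h) 3 ≡ 0ℤ →
  (∀ (i : Fin 8) → (series h ⊛ denominator′) (toℕ i) ≡ numerator′ (toℕ i)) →
  series h ≗ numerator ÷ denominator
series≗quotient h ann start small = quotient-criterion (series h) small λ n →
  trans (sym (Δ^-shift 5 (series h) 1 (2 + n))) (vanishes (annihilated-partialSum ann start) n)

series-afterMax : series (afterMax 3 0) ≗ numerator ÷ denominator
series-afterMax = series≗quotient _ ann-afterMax₃₀ refl
  (toWitness {a? = all? λ _ → _ ℤ.≟ _} tt)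

series-strictMax : series strictMax ≗ numerator ÷ denominator
series-strictMax = series≗quotient _ ann-strictMax refl
  (toWitness {a? = all? λ _ → _ ℤ.≟ _} tt)

-- Counting words letter by letter

record Count (P : List ℕ → Set) (n c : ℕ) : Set where
  field
    elements : List (List ℕ)
    unique   : Unique elements
    size     : length elements ≡ c
    members  : ∀ {w} → w ∈ elements ⇔ (length w ≡ n × P w)

open Count

-- Duplicate-free lists with the same members are permutations of each other.
count-unique : ∀ {P n c d} → Count P n c → Count P n d → c ≡ d
count-unique C D = trans (sym (size C)) (trans
  (↭-length (∼bag⇒↭ (unique∧set⇒bag (unique C) (unique D) (⇔-sym (members D) ⇔-∘ members C))))
  (size D))

count-cong : ∀ {P Q n c} → (∀ {w} → P w ⇔ Q w) → Count P n c → Count Q n c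
count-cong P⇔Q C = record
  { Count C
  ; members = mk⇔ (λ w∈ → let l , p = to (members C) w∈ in l , to P⇔Q p)
                  (λ (l , q) → from (members C) (l , from P⇔Q q)) }

count-empty : ∀ {P n} → (∀ {w} → length w ≡ n → ¬ P w) → Count P n 0
count-empty ¬P = record
  { elements = [] ; unique = [] ; size = refl
  ; members = mk⇔ (λ ()) (λ (l , p) → contradiction p (¬P l)) }

count-zero : ∀ {P} → P [] → Count P 0 1
count-zero {P} p = record
  { elements = [ [] ] ; unique = [] ∷ [] ; size = refl
  ; members = mk⇔ (λ { (here refl) → refl , p }) complete }
  where
  complete : ∀ {w} → length w ≡ 0 × P w → w ∈ [ [] ]
  complete {[]} _ = here refl

module _ (P : List ℕ → Set) where

  StartsIn : List ℕ → List ℕ → Set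
  StartsIn xs v = ∃₂ λ x w → x ∈ xs × v ≡ x ∷ w × P v

  -- Restricting the first letter to `xs` allows induction on the list of candidates; `count-suc`
  -- then removes the restriction.
  count-startsIn : ∀ {n xs cs} → Unique xs → Pointwise (λ x → Count (P ∘ (x ∷_)) n) xs cs →
    Count (StartsIn xs) (suc n) (List.sum cs)
  count-startsIn [] [] = count-empty λ { _ (_ , _ , () , _) }
  count-startsIn {n} {x ∷ xs} {c ∷ cs} (x∉xs ∷ xs!) (C ∷ Cs) = record
    { elements = map (x ∷_) (elements C) ++ elements D
    ; unique   = Unique.++⁺ (Unique.map⁺ List.∷-injectiveʳ (unique C)) (unique D) disjoint
    ; size     = trans (List.length-++ (map (x ∷_) (elements C)))
                       (cong₂ _+_ (trans (List.length-map (x ∷_) (elements C)) (size C)) (size D))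
    ; members  = mk⇔ sound complete
    }
    where
    D : Count (StartsIn xs) (suc n) (List.sum cs)
    D = count-startsIn xs! Cs

    disjoint : ∀ {v} → ¬ (v ∈ map (x ∷_) (elements C) × v ∈ elements D)
    disjoint (v∈C , v∈D)
      with _ , _ , refl ← ∈-map⁻ (x ∷_) v∈C
         | _ , _ , _ , x∈xs , refl , _ ← to (members D) v∈D = All.lookup x∉xs x∈xs refl

    sound : ∀ {v} → v ∈ map (x ∷_) (elements C) ++ elements D →
            length v ≡ suc n × StartsIn (x ∷ xs) v
    sound v∈ with ∈-++⁻ (map (x ∷_) (elements C)) v∈
    ... | inj₁ v∈C with w , w∈C , refl ← ∈-map⁻ (x ∷_) v∈C =
      let l , p = to (members C) w∈C in cong suc l , x , w , here refl , refl , p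
    ... | inj₂ v∈D =
      let l , y , w , y∈xs , eq , p = to (members D) v∈D in l , y , w , there y∈xs , eq , p

    complete : ∀ {v} → length v ≡ suc n × StartsIn (x ∷ xs) v →
               v ∈ map (x ∷_) (elements C) ++ elements D
    complete (l , _ , w , here refl , refl , p) =
      ∈-++⁺ˡ (∈-map⁺ (x ∷_) (from (members C) (suc-injective l , p)))
    complete (l , y , w , there y∈xs , eq , p) =
      ∈-++⁺ʳ (map (x ∷_) (elements C)) (from (members D) (l , y , w , y∈xs , eq , p))

  count-suc : ∀ {n xs cs} → Unique xs → (∀ {x w} → P (x ∷ w) → x ∈ xs) →
    Pointwise (λ x → Count (P ∘ (x ∷_)) n) xs cs → Count P (suc n) (List.sum cs)
  count-suc {xs = xs} xs! heads Cs = record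
    { Count C
    ; members = mk⇔ (λ v∈ → let l , _ , _ , _ , _ , p = to (members C) v∈ in l , p) complete }
    where
    C = count-startsIn xs! Cs
    complete : ∀ {v} → length v ≡ suc _ × P v → v ∈ elements C
    complete {x ∷ w} (l , p) = from (members C) (l , x , w , heads p , refl , p)

pointwise-applyUpTo : ∀ {A B : Set} {R : A → B → Set} f g n →
  (∀ {i} → i < n → R (f i) (g i)) → Pointwise R (applyUpTo f n) (applyUpTo g n)
pointwise-applyUpTo f g zero    Rfg = []
pointwise-applyUpTo f g (suc n) Rfg = Rfg z<s ∷ pointwise-applyUpTo (f ∘ suc) (g ∘ suc) n (Rfg ∘ s<s)

-- Continuations of a prefix and their admissible next letters

rise : ℕ → ℕ → ℕ
rise l x = if l <ᵇ x then 1 else 0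

rise-< : ∀ {l x} → l < x → rise l x ≡ 1
rise-< l<x rewrite to T-≡ (<⇒<ᵇ l<x) = refl

rise-refl : ∀ x → rise x x ≡ 0
rise-refl zero    = refl
rise-refl (suc x) = rise-refl x

-- w extends, as an ascent sequence, a sequence with a ascents and last letter l.
AscentTail : (a l : ℕ) → List ℕ → Set
AscentTail a l []      = ⊤
AscentTail a l (x ∷ w) = x ≤ suc a × AscentTail (rise l x + a) x w

NonzeroIncreasing : ℕ → List ℕ → Set
NonzeroIncreasing m []          = ⊤
NonzeroIncreasing m (zero ∷ w)  = NonzeroIncreasing m w
NonzeroIncreasing m (suc x ∷ w) = m ≤ suc x × NonzeroIncreasing (suc x) w

-- Phrased with sublists, to match pattern occurrences directly.
FewZeros : ℕ → List ℕ → Set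
FewZeros k w = ¬ (replicate k 0 ⊆ w)

Tail : (k m a l : ℕ) → List ℕ → Set
Tail k m a l w = AscentTail a l w × NonzeroIncreasing m w × FewZeros k w

fewZeros-0∷ : ∀ {k w} → FewZeros (suc k) (0 ∷ w) ⇔ FewZeros k w
fewZeros-0∷ = mk⇔ (λ few p → few (refl ∷ p)) (λ few p → few (∷⁻ p))

fewZeros-suc∷ : ∀ {k x w} → FewZeros (suc k) (suc x ∷ w) ⇔ FewZeros (suc k) w
fewZeros-suc∷ = mk⇔ (λ few p → few (_ ∷ʳ p)) (λ few p → few (∷ʳ⁻ (λ ()) p))

count-0∷ : ∀ {k m a a′} l {n c} → a ≡ a′ → Count (Tail k m a′ 0) n c →
  Count (Tail (suc k) m a l ∘ (0 ∷_)) n c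
count-0∷ l refl = count-cong
  (mk⇔ (λ (asc , inc , few) → (z≤n , asc) , inc , from fewZeros-0∷ few)
       (λ ((_ , asc) , inc , few) → asc , inc , to fewZeros-0∷ few))

count-suc∷ : ∀ {k m a a′} l {x n c} → m ≤ suc x → x ≤ a → rise l (suc x) + a ≡ a′ →
  Count (Tail (suc k) (suc x) a′ (suc x)) n c → Count (Tail (suc k) m a l ∘ (suc x ∷_)) n c
count-suc∷ l m≤x x≤a refl = count-cong
  (mk⇔ (λ (asc , inc , few) → (s≤s x≤a , asc) , (m≤x , inc) , from fewZeros-suc∷ few)
       (λ ((_ , asc) , (_ , inc) , few) → asc , inc , to fewZeros-suc∷ few))

-- Candidates for a letter above the maximum a ∸ s, after a ascents.  They are listed downwards, so
-- that the i-th one, as new maximum, is i less than the new number of ascents a + 1.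
letter : (a i : ℕ) → ℕ
letter a i = suc (a ∸ i)

letters : (a n : ℕ) → List ℕ
letters a = applyUpTo (letter a)

letters-unique : ∀ {a n} → n ≤ suc a → Unique (letters a n)
letters-unique n≤1+a = Unique.applyUpTo⁺₁ (letter _) _ λ i<j j<n eq →
  <⇒≢ (∸-monoʳ-< i<j (s≤s⁻¹ (≤-trans j<n n≤1+a))) (sym (suc-injective eq))

∈-letters : ∀ s {m x} → m ≤ x → x ≤ s + m → suc x ∈ letters (s + m) (suc s)
-- The index of `suc x` is `s + m ∸ x`.
∈-letters s {m} {x} m≤x x≤a = subst (λ y → suc y ∈ letters (s + m) (suc s)) (m∸[m∸n]≡n x≤a)
  (∈-applyUpTo⁺ (letter (s + m)) (s≤s (≤-trans (∸-monoʳ-≤ (s + m) m≤x) (≤-reflexive (m+n∸n≡m s m)))))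

letter-≥ : ∀ s m {i} → i ≤ s → m ≤ s + m ∸ i
letter-≥ s m {i} i≤s = begin
  m            ≡⟨ sym (m+n∸m≡n s m) ⟩
  s + m ∸ s    ≤⟨ ∸-monoʳ-≤ (s + m) i≤s ⟩
  s + m ∸ i    ∎
  where open ≤-Reasoning

mutual

  -- The maximum is `suc m`. The next letter is 0, the maximum or a larger one, and each choice
  -- leads to a state of the same two families.
  count-afterMax : ∀ k s m n →
    Count (Tail k (suc m) (s + suc m) (suc m)) n (afterMax k s n)
  count-afterMax zero    s m n       = count-empty λ _ (_ , _ , few) → few (minimum _)
  count-afterMax (suc k) s m zero    = count-zero (tt , tt , λ ())
  count-afterMax (suc k) s m (suc n) = count-suc (Tail (suc k) (suc m) a (suc m)) letters! heads
    (count-0∷ (suc m) (+-suc s m) (count-afterZero k s m n)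
    ∷ count-suc∷ (suc m) ≤-refl (≤-trans (n≤1+n m) (m≤n+m (suc m) s)) (cong (_+ a) (rise-refl m))
        (count-afterMax (suc k) s m n)
    ∷ count-letters k s (suc m) (suc m) (suc m) n λ m<x → s≤s (<⇒≤ m<x) , s≤s m<x)
    where
    a = s + suc m

    letters! : Unique (0 ∷ suc m ∷ letters a (suc s))
    letters! = ((λ ()) ∷ All.applyUpTo⁺₂ (letter a) _ (λ _ ()))
             ∷ All.applyUpTo⁺₁ (letter a) _ (λ { (s≤s i≤s) eq →
                 <⇒≢ (letter-≥ s (suc m) i≤s) (suc-injective eq) })
             ∷ letters-unique (s≤s (m≤m+n s (suc m)))

    heads : ∀ {x w} → Tail (suc k) (suc m) a (suc m) (x ∷ w) → x ∈ 0 ∷ suc m ∷ letters a (suc s)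
    heads {zero}  _ = here refl
    heads {suc x} ((s≤s x≤a , _) , (s≤s m≤x , _) , _) with m≤n⇒m<n∨m≡n m≤x
    ... | inj₁ m<x  = there (there (∈-letters s m<x x≤a))
    ... | inj₂ refl = there (here refl)

  -- The number of ascents `s + suc m` is written `suc s + m`: after a zero, `suc m` is an ascent as
  -- well, so the nonzero letters are handled like those above a maximum `m` with excess `suc s`.
  count-afterZero : ∀ k s m n → Count (Tail k (suc m) (suc s + m) 0) n (afterZero k s n)
  count-afterZero zero    s m n       = count-empty λ _ (_ , _ , few) → few (minimum _)
  count-afterZero (suc k) s m zero    = count-zero (tt , tt , λ ())
  count-afterZero (suc k) s m (suc n) = count-suc (Tail (suc k) (suc m) a 0) letters! heads
    (count-0∷ 0 refl (count-afterZero k s m n)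
    ∷ count-letters k (suc s) m (suc m) 0 n λ m≤x → s≤s m≤x , z<s)
    where
    a = suc s + m

    letters! : Unique (0 ∷ letters a (suc (suc s)))
    letters! = All.applyUpTo⁺₂ (letter a) _ (λ _ ()) ∷ letters-unique (s≤s (m≤m+n (suc s) m))

    heads : ∀ {x w} → Tail (suc k) (suc m) a 0 (x ∷ w) → x ∈ 0 ∷ letters a (suc (suc s))
    heads {zero}  _ = here refl
    heads {suc x} ((s≤s x≤a , _) , (s≤s m≤x , _) , _) = there (∈-letters (suc s) m≤x x≤a)

  count-letters : ∀ k s m m′ l n → (∀ {x} → m ≤ x → m′ ≤ suc x × l < suc x) →
    Pointwise (λ x → Count (Tail (suc k) m′ (s + m) l ∘ (x ∷_)) n)
              (letters (s + m) (suc s)) (applyUpTo (λ i → afterMax (suc k) i n) (suc s))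
  count-letters k s m m′ l n above = pointwise-applyUpTo (letter a) _ (suc s) count-letter
    where
    a = s + m
    count-letter : ∀ {i} → i < suc s →
      Count (Tail (suc k) m′ a l ∘ (letter a i ∷_)) n (afterMax (suc k) i n)
    count-letter {i} (s≤s i≤s) = count-suc∷ l m′≤x (m∸n≤m a i)
      (begin
        rise l (suc (a ∸ i)) + a   ≡⟨ cong (_+ a) (rise-< l<x) ⟩
        suc a                      ≡⟨ cong suc (sym (m+[n∸m]≡n (≤-trans i≤s (m≤m+n s m)))) ⟩
        suc (i + (a ∸ i))          ≡⟨ sym (+-suc i (a ∸ i)) ⟩
        i + suc (a ∸ i)            ∎)
      (count-afterMax (suc k) i (a ∸ i) n)
      where
      open ≡-Reasoning
      m′≤x = proj₁ (above (letter-≥ s m i≤s))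
      l<x  = proj₂ (above (letter-≥ s m i≤s))

-- Pattern occurrences as sublists

positive⇒suc : ∀ {n} (i : Fin (suc n)) → 0 < toℕ i → ∃ λ k → i ≡ suc k
positive⇒suc (suc k) _ = k , refl

-- Induction on `π`: its head is kept if `ι zero` is the first position. By monotonicity all
-- remaining positions are positive and can be lowered by one.
tabulate-⊆ : ∀ {m} (π : List ℕ) (ι : Fin m → Fin (length π)) →
  (∀ j k → j Fin.< k → ι j Fin.< ι k) → tabulate (lookup π ∘ ι) ⊆ π
tabulate-⊆ {zero}  π       ι mono = minimum π
tabulate-⊆ {suc m} []      ι mono with () ← ι zero
tabulate-⊆ {suc m} (x ∷ π) ι mono = cases (ι zero) refl
  where
  select : ∀ {l} (κ : Fin l → Fin (length (x ∷ π))) → (∀ j k → j Fin.< k → κ j Fin.< κ k) →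
           (∀ j → 0 < toℕ (κ j)) → tabulate (lookup (x ∷ π) ∘ κ) ⊆ π
  select κ κ-mono pos = subst (_⊆ π)
    (List.tabulate-cong λ j → cong (lookup (x ∷ π)) (sym (eq j)))
    (tabulate-⊆ π (proj₁ ∘ lower) λ j k j<k →
      s<s⁻¹ (subst₂ Fin._<_ (eq j) (eq k) (κ-mono j k j<k)))
    where
    lower = λ j → positive⇒suc (κ j) (pos j)
    eq    = λ j → proj₂ (lower j)

  later : ∀ j → 0 < toℕ (ι (suc j))
  later j = ≤-<-trans z≤n (mono zero (suc j) z<s)

  cases : ∀ i → ι zero ≡ i → tabulate (lookup (x ∷ π) ∘ ι) ⊆ x ∷ π
  cases zero    ι₀≡ = cong (lookup (x ∷ π)) ι₀≡ ∷
                      select (ι ∘ suc) (λ j k j<k → mono (suc j) (suc k) (s<s j<k)) later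
  cases (suc i) ι₀≡ = x ∷ʳ select ι mono λ where
    zero    → subst (λ k → 0 < toℕ k) (sym ι₀≡) z<s
    (suc j) → later j

module _ (φ : ℕ → ℕ) (φ-mono : φ Preserves _<_ ⟶ _<_) where

  position : ∀ τ {π} → map φ τ ⊆ π → Fin (length τ) → Fin (length π)
  position (t ∷ τ) (_ ∷ʳ p) j       = suc (position (t ∷ τ) p j)
  position (_ ∷ τ) (_ ∷ p)  zero    = zero
  position (_ ∷ τ) (_ ∷ p)  (suc j) = suc (position τ p j)

  position-mono : ∀ τ {π} (p : map φ τ ⊆ π) j k → j Fin.< k → position τ p j Fin.< position τ p k
  position-mono (t ∷ τ) (_ ∷ʳ p) j       k       j<k = s<s (position-mono (t ∷ τ) p j k j<k)
  position-mono (_ ∷ τ) (_ ∷ p)  zero    (suc k) j<k = z<s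
  position-mono (_ ∷ τ) (_ ∷ p)  (suc j) (suc k) j<k = s<s (position-mono τ p j k (s<s⁻¹ j<k))

  lookup-position : ∀ τ {π} (p : map φ τ ⊆ π) j → lookup π (position τ p j) ≡ φ (lookup τ j)
  lookup-position (t ∷ τ) (_ ∷ʳ p)   j       = lookup-position (t ∷ τ) p j
  lookup-position (_ ∷ τ) (eq ∷ p)   zero    = sym eq
  lookup-position (_ ∷ τ) (_ ∷ p)    (suc j) = lookup-position τ p j

  reflects-< : ∀ {x y} → φ x < φ y → x < y
  reflects-< {x} {y} φx<φy with <-cmp x y
  ... | tri< x<y _ _  = x<y
  ... | tri≈ _ refl _ = contradiction φx<φy (<-irrefl refl)
  ... | tri> _ _ y<x  = contradiction φx<φy (<⇒≯ (φ-mono y<x))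

  injective : ∀ {x y} → φ x ≡ φ y → x ≡ y
  injective {x} {y} φx≡φy with <-cmp x y
  ... | tri< x<y _ _ = contradiction φx≡φy (<⇒≢ (φ-mono x<y))
  ... | tri≈ _ x≡y _ = x≡y
  ... | tri> _ _ y<x = contradiction (sym φx≡φy) (<⇒≢ (φ-mono y<x))

  -- A strictly monotone relabelling preserves and reflects both order and equality, so a relabelled
  -- copy of the pattern is an occurrence.
  ⊆⇒contains : ∀ τ {π} → map φ τ ⊆ π → Contains π τ
  ⊆⇒contains τ {π} p = position τ p , position-mono τ p , λ j k →
    subst₂ (λ a b → ((a < b) ⇔ (lookup τ j < lookup τ k)) × ((a ≡ b) ⇔ (lookup τ j ≡ lookup τ k)))
           (sym (lookup-position τ p j)) (sym (lookup-position τ p k))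
           (mk⇔ reflects-< φ-mono , mk⇔ injective (cong φ))

-- Ascent and avoidance conditions on the word after the initial 0

relabel-021 : (x y : ℕ) → ℕ → ℕ
relabel-021 x y zero          = 0
relabel-021 x y (suc zero)    = x
-- The pattern letter 2 goes to `y`; larger arguments keep the map strictly monotone on all
-- naturals.
relabel-021 x y (suc (suc n)) = y + n

021-mono : ∀ {x y} → 0 < x → x < y → relabel-021 x y Preserves _<_ ⟶ _<_
021-mono         0<x x<y {zero}        {suc zero}    _   = 0<x
021-mono         0<x x<y {zero}        {suc (suc n)} _   = <-≤-trans 0<x (≤-trans (<⇒≤ x<y) (m≤m+n _ n))
021-mono         0<x x<y {suc zero}    {suc zero}    m<n = contradiction m<n (<-irrefl refl)
021-mono         0<x x<y {suc zero}    {suc (suc n)} _   = <-≤-trans x<y (m≤m+n _ n)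
021-mono {y = y} 0<x x<y {suc (suc m)} {suc zero}    (s<s ())
021-mono {y = y} 0<x x<y {suc (suc m)} {suc (suc n)} m<n = +-monoʳ-< y (s<s⁻¹ (s<s⁻¹ m<n))

ascentSequence⇔ : ∀ {x w} → IsAscentSequence (x ∷ w) ⇔ (x ≡ 0 × AscentTail 0 x w)
ascentSequence⇔ {x} {w} = mk⇔
  (λ (first , rest) → first zero refl , from (ascentTail⇔ 0 x w) (λ i → rest (suc i) z<s))
  (λ (x≡0 , asc) → (λ { zero _ → x≡0 }) , λ { (suc i) _ → to (ascentTail⇔ 0 x w) asc i })
  where
  -- Generalised to a prefix with `a` ascents and last letter `l`, so that induction on `w` goes
  -- through.
  ascentTail⇔ : ∀ a l w →
    AscentTail a l w ⇔ (∀ i → lookup w i ≤ a + asc (l ∷ take (toℕ i) w) + 1)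
  ascentTail⇔ a l []      = mk⇔ (λ _ ()) (λ _ → tt)
  ascentTail⇔ a l (x ∷ w) = mk⇔
    (λ { (x≤ , asc) zero    → subst (x ≤_) head≡ x≤
       ; (x≤ , asc) (suc i) → subst (lookup w i ≤_) (tail≡ i) (to IH asc i) })
    (λ h → subst (x ≤_) (sym head≡) (h zero) ,
           from IH λ i → subst (lookup w i ≤_) (sym (tail≡ i)) (h (suc i)))
    where
    IH = ascentTail⇔ (rise l x + a) x w
    head≡ : suc a ≡ a + 0 + 1
    head≡ = trans (cong suc (sym (+-identityʳ a))) (+-comm 1 (a + 0))
    tail≡ : ∀ i → rise l x + a + asc (x ∷ take (toℕ i) w) + 1
                ≡ a + (rise l x + asc (x ∷ take (toℕ i) w)) + 1
    tail≡ i = cong (_+ 1) (trans (cong (_+ asc (x ∷ take (toℕ i) w)) (+-comm (rise l x) a))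
                                 (+-assoc a (rise l x) _))

occurrence-⊆ : ∀ {π} τ ((ι , _) : Contains π τ) → tabulate (lookup π ∘ ι) ⊆ π
occurrence-⊆ {π} τ (ι , mono , _) = tabulate-⊆ π ι mono

occurrence-< : ∀ {π} τ ((ι , _) : Contains π τ) j k → lookup τ j < lookup τ k →
  lookup π (ι j) < lookup π (ι k)
occurrence-< τ (_ , _ , iso) j k = from (proj₁ (iso j k))

occurrence-≡ : ∀ {π} τ ((ι , _) : Contains π τ) j k → lookup τ j ≡ lookup τ k →
  lookup π (ι j) ≡ lookup π (ι k)
occurrence-≡ τ (_ , _ , iso) j k = from (proj₂ (iso j k))

bounded-below : ∀ {m w x} → NonzeroIncreasing m w → x ∷ [] ⊆ w → x ≡ 0 ⊎ m ≤ x
bounded-below {w = zero ∷ w}  inc         (_ ∷ʳ p)   = bounded-below inc p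
bounded-below {w = zero ∷ w}  inc         (refl ∷ p) = inj₁ refl
bounded-below {w = suc y ∷ w} (m≤y , inc) (refl ∷ p) = inj₂ m≤y
bounded-below {w = suc y ∷ w} (m≤y , inc) (_ ∷ʳ p) with bounded-below inc p
... | inj₁ x≡0 = inj₁ x≡0
... | inj₂ y≤x = inj₂ (≤-trans m≤y y≤x)

-- A nonzero `x` bounds all later nonzero letters from below. In pattern occurrences this forces the
-- lower letter of a descent to be an actual 0.
descent-to-zero : ∀ {m w x y} → NonzeroIncreasing m w → x ∷ y ∷ [] ⊆ w → y < x → y ≡ 0
descent-to-zero {w = zero ∷ w}  inc       (_ ∷ʳ p)   y<x = descent-to-zero inc p y<x
descent-to-zero {w = zero ∷ w}  inc       (refl ∷ p) ()
descent-to-zero {w = suc _ ∷ w} (_ , inc) (_ ∷ʳ p)   y<x = descent-to-zero inc p y<x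
descent-to-zero {w = suc _ ∷ w} (_ , inc) (refl ∷ p) y<x with bounded-below inc p
... | inj₁ y≡0 = y≡0
... | inj₂ x≤y = contradiction y<x (≤⇒≯ x≤y)

-- With the bound `m` placed in front of the word, a nonzero letter below it is itself a forbidden
-- descent; zeros are skipped while `m` stays in front.
nonzeroIncreasing⁺ : ∀ m w → (∀ {x y} → 0 < x → x < y → ¬ (y ∷ x ∷ [] ⊆ m ∷ w)) →
  NonzeroIncreasing m w
nonzeroIncreasing⁺ m []          noDescent = tt
nonzeroIncreasing⁺ m (zero ∷ w)  noDescent =
  nonzeroIncreasing⁺ m w λ 0<x x<y p → noDescent 0<x x<y (⊆-trans p (refl ∷ 0 ∷ʳ ⊆-refl))
nonzeroIncreasing⁺ m (suc z ∷ w) noDescent =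
    ≮⇒≥ (λ z<m → noDescent z<s z<m (refl ∷ refl ∷ minimum w))
  , nonzeroIncreasing⁺ (suc z) w λ 0<x x<y p → noDescent 0<x x<y (m ∷ʳ p)

-- The initial 0 can serve as the 0 of the pattern, so only descents between nonzero letters matter.
avoids-021⇔ : ∀ {w} → Avoids (0 ∷ w) (0 ∷ 2 ∷ 1 ∷ []) ⇔ NonzeroIncreasing 0 w
avoids-021⇔ {w} = mk⇔ to′ from′
  where
  τ = 0 ∷ 2 ∷ 1 ∷ []

  to′ : Avoids (0 ∷ w) τ → NonzeroIncreasing 0 w
  to′ avoids = nonzeroIncreasing⁺ 0 w λ {x} {y} 0<x x<y p →
    avoids (⊆⇒contains (relabel-021 x y) (021-mono 0<x x<y) τ
      (refl ∷ subst (λ z → z ∷ x ∷ [] ⊆ w) (sym (+-identityʳ y))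
                (∷ʳ⁻ (λ y≡0 → contradiction (subst (x <_) y≡0 x<y) λ ()) p)))

  from′ : NonzeroIncreasing 0 w → Avoids (0 ∷ w) τ
  from′ inc c = n≮0 (<-≤-trans (occurrence-< τ c zero (suc (suc zero)) z<s)
    (≤-reflexive (descent-to-zero inc (∷⁻ (occurrence-⊆ τ c))
                                  (occurrence-< τ c (suc (suc zero)) (suc zero) (s<s z<s)))))

-- Relabels the patterns with letters 0 and 1, sending 0 to 0 and 1 to `suc x`.
scale-mono : ∀ x → (suc x *_) Preserves _<_ ⟶ _<_
scale-mono x = *-monoʳ-< (suc x)

FewZerosAfterNonzero : List ℕ → Set
FewZerosAfterNonzero []          = ⊤
FewZerosAfterNonzero (zero ∷ w)  = FewZerosAfterNonzero w
FewZerosAfterNonzero (suc _ ∷ w) = FewZeros 3 w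

fewZerosAfterNonzero⁺ : ∀ w → (∀ x → ¬ (suc x ∷ 0 ∷ 0 ∷ 0 ∷ [] ⊆ w)) → FewZerosAfterNonzero w
fewZerosAfterNonzero⁺ []          avoids = tt
fewZerosAfterNonzero⁺ (zero ∷ w)  avoids = fewZerosAfterNonzero⁺ w λ x p → avoids x (0 ∷ʳ p)
fewZerosAfterNonzero⁺ (suc x ∷ w) avoids = λ p → avoids x (refl ∷ p)

fewZerosAfterNonzero⁻ : ∀ w {x} → FewZerosAfterNonzero w → ¬ (suc x ∷ 0 ∷ 0 ∷ 0 ∷ [] ⊆ w)
fewZerosAfterNonzero⁻ (zero ∷ w)  few (_ ∷ʳ p) = fewZerosAfterNonzero⁻ w few p
fewZerosAfterNonzero⁻ (suc _ ∷ w) few p        = few (∷⁻ p)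

avoids-1000⇔ : ∀ {w} → NonzeroIncreasing 0 w →
  Avoids (0 ∷ w) (1 ∷ 0 ∷ 0 ∷ 0 ∷ []) ⇔ FewZerosAfterNonzero w
avoids-1000⇔ {w} inc = mk⇔
  (λ avoids → fewZerosAfterNonzero⁺ w λ x p → avoids (⊆⇒contains (suc x *_) (scale-mono x) τ
    (subst₂ (λ a b → a ∷ b ∷ b ∷ b ∷ [] ⊆ 0 ∷ w) (sym (*-identityʳ (suc x))) (sym (*-zeroʳ (suc x)))
            (0 ∷ʳ p))))
  (λ few c → absurd few (occurrence-⊆ τ c) (occurrence-< τ c (suc zero) zero z<s)
    (occurrence-≡ τ c (suc zero) (suc (suc zero)) refl)
    (occurrence-≡ τ c (suc zero) (suc (suc (suc zero))) refl))
  where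
  τ = 1 ∷ 0 ∷ 0 ∷ 0 ∷ []

  absurd : ∀ {x y y′ y″} → FewZerosAfterNonzero w → x ∷ y ∷ y′ ∷ y″ ∷ [] ⊆ 0 ∷ w → y < x →
           y ≡ y′ → ¬ (y ≡ y″)
  absurd {suc x} few p y<x refl refl
    -- The first two letters of the occurrence form a descent, so its three equal letters are zeros.
    with refl ← descent-to-zero {m = 0} {w = 0 ∷ w} inc (⊆-trans (refl ∷ refl ∷ minimum _) p) y<x
    = fewZerosAfterNonzero⁻ (0 ∷ w) few p

-- Here m is the letter preceding w, or the last nonzero one before it.
FewZerosAfterRepeat : ℕ → List ℕ → Set
FewZerosAfterRepeat m []          = ⊤
FewZerosAfterRepeat m (zero ∷ w)  = FewZerosAfterRepeat m w
FewZerosAfterRepeat m (suc x ∷ w) =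
  (m ≡ suc x → FewZeros 2 w) × (m ≢ suc x → FewZerosAfterRepeat (suc x) w)

fewZerosAfterRepeat⁺ : ∀ m w → (∀ x → ¬ (suc x ∷ suc x ∷ 0 ∷ 0 ∷ [] ⊆ m ∷ w)) →
  FewZerosAfterRepeat m w
fewZerosAfterRepeat⁺ m []          avoids = tt
fewZerosAfterRepeat⁺ m (zero ∷ w)  avoids =
  fewZerosAfterRepeat⁺ m w λ x p → avoids x (⊆-trans p (refl ∷ 0 ∷ʳ ⊆-refl))
fewZerosAfterRepeat⁺ m (suc y ∷ w) avoids =
    (λ { refl p → avoids y (refl ∷ refl ∷ p) })
  , (λ _ → fewZerosAfterRepeat⁺ (suc y) w λ x p → avoids x (m ∷ʳ p))

-- Weak increase leaves only zeros or further equal letters between two equal nonzero letters, so a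
-- repeat shows up already between consecutive nonzero letters.
fewZerosAfterRepeat⁻ : ∀ m w {x} → NonzeroIncreasing m w → FewZerosAfterRepeat m w →
  ¬ (suc x ∷ suc x ∷ 0 ∷ 0 ∷ [] ⊆ m ∷ w)
fewZerosAfterRepeat⁻ m []          inc         few (_ ∷ʳ ())
fewZerosAfterRepeat⁻ m []          inc         few (_ ∷ ())
fewZerosAfterRepeat⁻ m (zero ∷ w)  inc         few (_ ∷ʳ p) =
  fewZerosAfterRepeat⁻ m w inc few (m ∷ʳ ∷ʳ⁻ (λ ()) p)
fewZerosAfterRepeat⁻ m (zero ∷ w)  inc         few (eq ∷ p) =
  fewZerosAfterRepeat⁻ m w inc few (eq ∷ ∷ʳ⁻ (λ ()) p)
fewZerosAfterRepeat⁻ m (suc y ∷ w) (m≤y , inc) (few , few′) p with m ≟ suc y | p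
... | yes m≡y | p        = few m≡y (∷⁻ (∷⁻ p))
... | no m≢y  | _ ∷ʳ p   = fewZerosAfterRepeat⁻ (suc y) w inc (few′ m≢y) p
-- Here `m` would have to recur after the larger letter `suc y`.
... | no m≢y  | refl ∷ p with bounded-below inc (⊆-trans (refl ∷ minimum _) (∷ʳ⁻ m≢y p))
...   | inj₂ y≤m = m≢y (≤-antisym m≤y y≤m)

avoids-1100⇔ : ∀ {w} → NonzeroIncreasing 0 w →
  Avoids (0 ∷ w) (1 ∷ 1 ∷ 0 ∷ 0 ∷ []) ⇔ FewZerosAfterRepeat 0 w
avoids-1100⇔ {w} inc = mk⇔
  (λ avoids → fewZerosAfterRepeat⁺ 0 w λ x p → avoids (⊆⇒contains (suc x *_) (scale-mono x) τ
    (subst₂ (λ a b → a ∷ a ∷ b ∷ b ∷ [] ⊆ 0 ∷ w) (sym (*-identityʳ (suc x))) (sym (*-zeroʳ (suc x)))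
            p)))
  (λ few c → absurd few (occurrence-⊆ τ c) (occurrence-< τ c (suc (suc zero)) zero z<s)
    (occurrence-≡ τ c zero (suc zero) refl)
    (occurrence-≡ τ c (suc (suc zero)) (suc (suc (suc zero))) refl))
  where
  τ = 1 ∷ 1 ∷ 0 ∷ 0 ∷ []

  absurd : ∀ {x x′ y y′} → FewZerosAfterRepeat 0 w → x ∷ x′ ∷ y ∷ y′ ∷ [] ⊆ 0 ∷ w → y < x →
           x ≡ x′ → ¬ (y ≡ y′)
  absurd {suc x} few p y<x refl refl
    with refl ← descent-to-zero {m = 0} {w = 0 ∷ w} inc (⊆-trans (refl ∷ _ ∷ʳ refl ∷ minimum _) p) y<x
    = fewZerosAfterRepeat⁻ 0 w inc few p

-- Enumeration of both classes and the generating function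

count-partialSum : ∀ {T h} → T [] → (∀ {w} → T w ⇔ T (0 ∷ w)) → (∀ {x w} → T (x ∷ w) → x ≤ 1) →
  (∀ n → Count (T ∘ (1 ∷_)) n (h n)) → ∀ n → Count T n (partialSum h n)
count-partialSum {T} {h} T[] T-0∷ small count-1∷ = go
  where
  heads : ∀ {x w} → T (x ∷ w) → x ∈ 0 ∷ 1 ∷ []
  heads t with small t
  ... | z≤n     = here refl
  ... | s≤s z≤n = there (here refl)

  go : ∀ n → Count T n (partialSum h n)
  go zero    = count-zero T[]
  -- Another 0 prolongs the initial run of zeros; a 1 ends it.
  go (suc n) = subst (Count T (suc n)) (cong (λ c → partialSum h n + c) (+-identityʳ (h n)))
    (count-suc T (((λ ()) ∷ []) ∷ [] ∷ []) heads (count-cong T-0∷ (go n) ∷ count-1∷ n ∷ []))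

Tail-1000 : List ℕ → Set
Tail-1000 w = AscentTail 0 0 w × NonzeroIncreasing 0 w × FewZerosAfterNonzero w

count-1000 : ∀ n → Count Tail-1000 n (partialSum (afterMax 3 0) n)
count-1000 = count-partialSum (tt , tt , tt)
  (mk⇔ (λ (asc , rest) → (z≤n , asc) , rest) (λ ((_ , asc) , rest) → asc , rest))
  (λ ((x≤1 , _) , _) → x≤1)
  λ n → count-cong
    (mk⇔ (λ (asc , inc , few) → (≤-refl , asc) , (z≤n , inc) , few)
         (λ ((_ , asc) , (_ , inc) , few) → asc , inc , few))
    (count-afterMax 3 0 0 n)

-- While the nonzero letters are distinct they are 1, 2, 3, ..., so `m` is both the maximum and the
-- number of ascents.
StrictTail : (m l : ℕ) → List ℕ → Set
StrictTail m l w = AscentTail m l w × NonzeroIncreasing m w × FewZerosAfterRepeat m w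

count-strict-0∷ : ∀ {m} l {n c} → Count (StrictTail m 0) n c → Count (StrictTail m l ∘ (0 ∷_)) n c
count-strict-0∷ l = count-cong
  (mk⇔ (λ (asc , rest) → (z≤n , asc) , rest) (λ ((_ , asc) , rest) → asc , rest))

count-strict-repeat : ∀ {m} l s {n c} → rise l (suc m) ≡ s →
  Count (Tail 2 (suc m) (s + suc m) (suc m)) n c →
  Count (StrictTail (suc m) l ∘ (suc m ∷_)) n c
count-strict-repeat l s refl = count-cong
  (mk⇔ (λ (asc , inc , few) → (n≤1+n _ , asc) , (≤-refl , inc) , (λ _ → few) , contradiction refl)
       (λ ((_ , asc) , (_ , inc) , few , _) → asc , inc , few refl))

count-strict-new : ∀ {m} l {n c} → rise l (suc m) ≡ 1 → Count (StrictTail (suc m) (suc m)) n c →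
  Count (StrictTail m l ∘ (suc m ∷_)) n c
count-strict-new {m} l rise≡1 = count-cong
  (mk⇔ (λ (asc , inc , few) →
           (≤-refl , subst (λ r → AscentTail (r + m) (suc m) _) (sym rise≡1) asc) ,
           (n≤1+n m , inc) , (λ m≡1+m → contradiction (sym m≡1+m) 1+n≢n) , (λ _ → few))
       (λ ((_ , asc) , (_ , inc) , _ , few) →
           subst (λ r → AscentTail (r + m) (suc m) _) rise≡1 asc , inc , few (1+n≢n ∘ sym)))

strict-letters-unique : ∀ m → Unique (0 ∷ suc m ∷ suc (suc m) ∷ [])
strict-letters-unique m = ((λ ()) ∷ (λ ()) ∷ []) ∷ ((λ ()) ∷ []) ∷ [] ∷ []

strict-letters : ∀ {m l x w} → StrictTail (suc m) l (x ∷ w) → x ∈ 0 ∷ suc m ∷ suc (suc m) ∷ []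
strict-letters {x = zero}  _ = here refl
strict-letters {x = suc x} ((x≤ , _) , (m≤x , _) , _) with m≤n⇒m<n∨m≡n m≤x
... | inj₁ m<x  = there (there (here (≤-antisym x≤ m<x)))
... | inj₂ refl = there (here refl)

count-strictMax  : ∀ m n → Count (StrictTail (suc m) (suc m)) n (strictMax n)
count-strictZero : ∀ m n → Count (StrictTail (suc m) 0) n (strictZero n)

count-strictMax m zero    = count-zero (tt , tt , tt)
count-strictMax m (suc n) = subst (Count _ (suc n))
  (cong (λ c → strictZero n + (afterMax 2 0 n + c)) (+-identityʳ (strictMax n)))
  (count-suc (StrictTail (suc m) (suc m)) (strict-letters-unique m) strict-letters
    ( count-strict-0∷ (suc m) (count-strictZero m n)
    ∷ count-strict-repeat (suc m) 0 (rise-refl m) (count-afterMax 2 0 m n)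
    ∷ count-strict-new (suc m) (rise-< (n<1+n m)) (count-strictMax (suc m) n)
    ∷ []))

count-strictZero m zero    = count-zero (tt , tt , tt)
count-strictZero m (suc n) = subst (Count _ (suc n))
  (cong (λ c → strictZero n + (afterMax 2 1 n + c)) (+-identityʳ (strictMax n)))
  (count-suc (StrictTail (suc m) 0) (strict-letters-unique m) strict-letters
    ( count-strict-0∷ 0 (count-strictZero m n)
    ∷ count-strict-repeat 0 1 refl (count-afterMax 2 1 m n)
    ∷ count-strict-new 0 refl (count-strictMax (suc m) n)
    ∷ []))

Tail-1100 : List ℕ → Set
Tail-1100 = StrictTail 0 0

count-1100 : ∀ n → Count Tail-1100 n (partialSum strictMax n)
count-1100 = count-partialSum (tt , tt , tt)
  (mk⇔ (λ (asc , rest) → (z≤n , asc) , rest) (λ ((_ , asc) , rest) → asc , rest))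
  (λ ((x≤1 , _) , _) → x≤1)
  λ n → count-strict-new 0 refl (count-strictMax 0 n)

-- The first letter must be 0. Removing it turns the defining conditions into those on the remaining
-- word, and two enumerations of one set have equal size.
f≗series : ∀ τ {X : List ℕ → Set} {h} → b 0 τ ≡ 1 →
  (∀ {w} → NonzeroIncreasing 0 w → Avoids (0 ∷ w) τ ⇔ X w) →
  (∀ n → Count (λ w → AscentTail 0 0 w × NonzeroIncreasing 0 w × X w) n (partialSum h n)) →
  f τ ≗ series h
f≗series τ b₀≡1 avoids⇔ counts zero    = cong +_ b₀≡1
f≗series τ {X} {h} b₀≡1 avoids⇔ counts (suc n) = cong +_
  (trans (count-unique count-b (count-suc Q ([] ∷ []) heads (count-after-0 ∷ [])))
         (+-identityʳ (partialSum h n)))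
  where
  Q : List ℕ → Set
  Q w = IsAscentSequence w × Avoids w (0 ∷ 2 ∷ 1 ∷ []) × Avoids w τ

  count-b : Count Q (suc n) (b (suc n) τ)
  count-b = record
    { elements = listB (suc n) τ ; unique = listB-unique (suc n) τ ; size = refl
    ; members = λ {w} → ∈-listB (suc n) τ w }

  heads : ∀ {x w} → Q (x ∷ w) → x ∈ 0 ∷ []
  heads (asc , _) = here (proj₁ (to ascentSequence⇔ asc))

  count-after-0 : Count (Q ∘ (0 ∷_)) n (partialSum h n)
  count-after-0 = count-cong {P = λ w → AscentTail 0 0 w × NonzeroIncreasing 0 w × X w} {Q ∘ (0 ∷_)}
    (mk⇔ (λ (asc , inc , x) → from ascentSequence⇔ (refl , asc) , from avoids-021⇔ inc ,
                               from (avoids⇔ inc) x)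
         (λ (asc , avoids , avoids′) → let inc = to avoids-021⇔ avoids in
            proj₂ (to ascentSequence⇔ asc) , inc , to (avoids⇔ inc) avoids′))
    (counts n)

theorem2p4 : (τ : List ℕ) → (τ ≡ 1 ∷ 0 ∷ 0 ∷ 0 ∷ []) ⊎ (τ ≡ 1 ∷ 1 ∷ 0 ∷ 0 ∷ []) →
    f τ ≗ (poly (+ 1 ∷ - + 1 ∷ []) ⊛ poly (+ 1 ∷ - + 8 ∷ + 24 ∷ - + 31 ∷ + 13 ∷ + 2 ∷ + 2 ∷ [])) ÷ (poly (+ 1 ∷ - + 2 ∷ []) ^ₛ 5)
theorem2p4 τ (inj₁ refl) n = trans (f≗series τ refl avoids-1000⇔ count-1000 n) (series-afterMax n)
theorem2p4 τ (inj₂ refl) n = trans (f≗series τ refl avoids-1100⇔ count-1100 n) (series-strictMax n)
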